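{- Let $\tau(n)$, $n\ge1$, be the integers defined by $$\Delta(q)=q\prod_{m\ge1}(1-q^m)^{24}=\sum_{n\ge1}\tau(n)q^n.$$ Then for every integer $n\ge1$: $\tau(2n)\equiv0\pmod2$, $\tau(3n-1)\equiv0\pmod3$, and $\tau(3n)\equiv0\pmod3$.
   Context: $\tau$ is Ramanujan's tau function; the product is understood as a formal power series in $q$. -}

module Defs where

open import Data.Bool.Base using (if_then_else_)
open import Data.Fin.Base using (toℕ)
open import Data.Integer.Base using (ℤ; +_; 0ℤ; 1ℤ; _+_; _-_; _*_)
open import Data.Integer.Divisibility using (_∣_)
open import Data.Integer.Properties
  using (+-0-commutativeMonoid; *-identityʳ; *-zeroʳ; +-identityˡ; +-identityʳ)
open import Data.Nat.Base using (ℕ; zero; suc; _∸_; _≤_; _<_; s≤s; _≤′_; ≤′-refl; ≤′-step)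
open import Data.Nat.Properties using (_≟_; <⇒≢; m∸n≤m; ≤-<-trans; ≤⇒≤′; ≤′⇒≤)
open import Data.Product.Base using (∃-syntax; _,_)
open import Relation.Binary.PropositionalEquality
  using (_≡_; refl; sym; trans; cong; cong₂)
open import Relation.Nullary.Decidable using (does; dec-false)

open import Algebra.Properties.CommutativeMonoid.Sum +-0-commutativeMonoid
  using (sum; sum-cong-≗; sum-syntax)

infix  4 _≡_mod_ _⟶_
infixl 6 _⊖_
infixl 7 _⊛_
infixr 8 _⊛^_
infix  9 q^_

_≡_mod_ : ℤ → ℤ → ℕ → Set
a ≡ b mod m = + m ∣ a - b

-- Formal power series over ℤ in q, as coefficient functions.
Series : Set
Series = ℕ → ℤ

q^_ : ℕ → Series
(q^ k) n = if does (n ≟ k) then 1ℤ else 0ℤ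

𝟙 : Series
𝟙 = q^ 0

_⊖_ : Series → Series → Series
(f ⊖ g) n = f n - g n

_⊛_ : Series → Series → Series
(f ⊛ g) n = ∑[ i < suc n ] (f (toℕ i) * g (n ∸ toℕ i))

_⊛^_ : Series → ℕ → Series
f ⊛^ zero  = 𝟙
f ⊛^ suc k = f ⊛ (f ⊛^ k)

-- F 1 ⊛ F 2 ⊛ … ⊛ F N; the factor F 0 is not used.
∏≤ : ℕ → (ℕ → Series) → Series
∏≤ zero    F = 𝟙
∏≤ (suc N) F = ∏≤ N F ⊛ F (suc N)

-- Convergence of formal power series (q-adic): every coefficient is
-- eventually constant.
_⟶_ : (ℕ → Series) → Series → Set
s ⟶ f = ∀ n → ∃[ N ] (∀ M → N ≤ M → s M n ≡ f n)

-- The infinite product F 1 ⊛ F 2 ⊛ ….  Its n-th coefficient is read off from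
-- the n-th partial product, which gives the limit of the partial products
-- whenever F m ≡ 1 modulo q^m; for the factors of Δ see factor-converges.
∏∞ : (ℕ → Series) → Series
∏∞ F n = ∏≤ n F n

factor : ℕ → Series
factor m = (𝟙 ⊖ q^ m) ⊛^ 24

Δ : Series
Δ = q^ 1 ⊛ ∏∞ factor

-- Indexed from 0 for convenience; the constant coefficient τ 0 is 0.
τ : ℕ → ℤ
τ n = Δ n

private
  ⊛-𝟙 : ∀ f n → (f ⊛ 𝟙) n ≡ f n
  ⊛-𝟙 f zero    = trans (+-identityʳ _) (*-identityʳ (f 0))
  ⊛-𝟙 f (suc n) =
    trans (cong₂ _+_ (*-zeroʳ (f 0)) (⊛-𝟙 (λ i → f (suc i)) n)) (+-identityˡ _)

  ⊛-≈𝟙 : ∀ {k} f g → (∀ n → n < k → g n ≡ 𝟙 n) →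
         ∀ n → n < k → (f ⊛ g) n ≡ f n
  ⊛-≈𝟙 f g g≈𝟙 n n<k = trans
    (sum-cong-≗ {suc n} λ i → cong (f (toℕ i) *_)
      (g≈𝟙 (n ∸ toℕ i) (≤-<-trans (m∸n≤m n (toℕ i)) n<k)))
    (⊛-𝟙 f n)

  ^-≈𝟙 : ∀ {k} g → (∀ n → n < k → g n ≡ 𝟙 n) →
         ∀ j n → n < k → (g ⊛^ j) n ≡ 𝟙 n
  ^-≈𝟙 g g≈𝟙 zero    n n<k = refl
  ^-≈𝟙 g g≈𝟙 (suc j) n n<k =
    trans (⊛-≈𝟙 g (g ⊛^ j) (^-≈𝟙 g g≈𝟙 j) n n<k) (g≈𝟙 n n<k)

  1-q^-≈𝟙 : ∀ k n → n < k → (𝟙 ⊖ q^ k) n ≡ 𝟙 n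
  1-q^-≈𝟙 k n n<k = trans
    (cong (λ b → 𝟙 n - (if b then 1ℤ else 0ℤ)) (dec-false (n ≟ k) (<⇒≢ n<k)))
    (+-identityʳ (𝟙 n))

∏∞-converges : ∀ F → (∀ m n → n < m → F m n ≡ 𝟙 n) →
               (λ N → ∏≤ N F) ⟶ ∏∞ F
∏∞-converges F F≈𝟙 n = n , λ M n≤M → go (≤⇒≤′ n≤M)
  where
  go : ∀ {M} → n ≤′ M → ∏≤ M F n ≡ ∏≤ n F n
  go ≤′-refl = refl
  go {suc M} (≤′-step n≤M) = trans
    (⊛-≈𝟙 (∏≤ M F) (F (suc M)) (F≈𝟙 (suc M)) n (s≤s (≤′⇒≤ n≤M)))
    (go n≤M)

factor-converges : (λ N → ∏≤ N factor) ⟶ ∏∞ factor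
factor-converges =
  ∏∞-converges factor λ m → ^-≈𝟙 (𝟙 ⊖ q^ m) (1-q^-≈𝟙 m) 24

{-# OPTIONS --safe #-}
-- For p ∈ {2, 3} the Frobenius congruence (1 - x)^p ≡ 1 - x^p (mod p), applied
-- to x = q^m and to an exponent 24 divisible by p, shows that modulo p every
-- factor (1 - q^m)^24 is a power series in q^p. Hence so is the infinite
-- product, and modulo p only exponents n ≡ 1 (mod p) occur in Δ.
module Submission where

open import Defs
open import Data.Bool.Base using (if_then_else_)
open import Data.Fin.Base as Fin using (Fin; toℕ)
open import Data.Fin.Properties using (toℕ≤pred[n])
open import Data.Integer.Base as ℤ using (ℤ; +_; 0ℤ; 1ℤ)
import Data.Integer.Properties as ℤ
open import Data.Integer.Divisibility.Signed
open import Data.Integer.Tactic.RingSolver using (solve-∀)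
open import Data.Nat.Base using (ℕ; zero; suc; _+_; _*_; _∸_; _≤_)
import Data.Nat.Properties as ℕ
open import Data.Product.Base using (_×_; _,_)
open import Data.Sum.Base using (_⊎_; inj₁; inj₂; [_,_]′; map₁; map₂)
open import Relation.Binary.PropositionalEquality
open import Relation.Nullary.Decidable using (yes; no; dec-false; from-no)
open import Relation.Nullary.Negation using (¬_; contradiction)

open import Algebra.Properties.CommutativeMonoid.Sum ℤ.+-0-commutativeMonoid
  using (sum; sum-cong-≗)

private
  variable
    p r s : ℤ
    f g h : Series

⊛-congˡ : ∀ f → g ≗ h → f ⊛ g ≗ f ⊛ h
⊛-congˡ f g≗h n = sum-cong-≗ {suc n} λ i → cong (f (toℕ i) ℤ.*_) (g≗h (n ∸ toℕ i))

⊛-distribʳ-⊖ : ∀ h f g → (f ⊖ g) ⊛ h ≗ (f ⊛ h) ⊖ (g ⊛ h)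
⊛-distribʳ-⊖ h f g zero = ring (f 0) (g 0) (h 0)
  where
  ring : ∀ a b c → (a ℤ.- b) ℤ.* c ℤ.+ 0ℤ ≡ (a ℤ.* c ℤ.+ 0ℤ) ℤ.- (b ℤ.* c ℤ.+ 0ℤ)
  ring = solve-∀
⊛-distribʳ-⊖ h f g (suc n) = trans
  (cong (λ z → (f 0 ℤ.- g 0) ℤ.* h (suc n) ℤ.+ z)
    (⊛-distribʳ-⊖ h (λ i → f (suc i)) (λ i → g (suc i)) n))
  (ring (f 0) (g 0) (h (suc n)) _ _)
  where
  ring : ∀ a b c x y →
    (a ℤ.- b) ℤ.* c ℤ.+ (x ℤ.- y) ≡ (a ℤ.* c ℤ.+ x) ℤ.- (b ℤ.* c ℤ.+ y)
  ring = solve-∀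

⊛-distribˡ-⊖ : ∀ f g h → f ⊛ (g ⊖ h) ≗ (f ⊛ g) ⊖ (f ⊛ h)
⊛-distribˡ-⊖ f g h zero = ring (f 0) (g 0) (h 0)
  where
  ring : ∀ a b c → a ℤ.* (b ℤ.- c) ℤ.+ 0ℤ ≡ (a ℤ.* b ℤ.+ 0ℤ) ℤ.- (a ℤ.* c ℤ.+ 0ℤ)
  ring = solve-∀
⊛-distribˡ-⊖ f g h (suc n) = trans
  (cong (λ z → f 0 ℤ.* (g (suc n) ℤ.- h (suc n)) ℤ.+ z)
    (⊛-distribˡ-⊖ (λ i → f (suc i)) g h n))
  (ring (f 0) (g (suc n)) (h (suc n)) _ _)
  where
  ring : ∀ a b c x y →
    a ℤ.* (b ℤ.- c) ℤ.+ (x ℤ.- y) ≡ (a ℤ.* b ℤ.+ x) ℤ.- (a ℤ.* c ℤ.+ y)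
  ring = solve-∀

⊛-zeroˡ : ∀ h → (λ _ → 0ℤ) ⊛ h ≗ λ _ → 0ℤ
⊛-zeroˡ h zero    = refl
⊛-zeroˡ h (suc n) = trans (ℤ.+-identityˡ _) (⊛-zeroˡ h n)

⊛-identityˡ : ∀ h → 𝟙 ⊛ h ≗ h
⊛-identityˡ h zero    = trans (ℤ.+-identityʳ _) (ℤ.*-identityˡ (h 0))
⊛-identityˡ h (suc n) =
  trans (cong₂ ℤ._+_ (ℤ.*-identityˡ (h (suc n))) (⊛-zeroˡ h n)) (ℤ.+-identityʳ _)

[𝟙⊖x]⊛ : ∀ x h → (𝟙 ⊖ x) ⊛ h ≗ h ⊖ (x ⊛ h)
[𝟙⊖x]⊛ x h n =
  trans (⊛-distribʳ-⊖ h 𝟙 x n) (cong (ℤ._- (x ⊛ h) n) (⊛-identityˡ h n))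

-- Products act on an arbitrary series `h` from the left, the shape in which `⊛^` nests its factors.
[𝟙⊖x]²⊛ : ∀ x h n → ((𝟙 ⊖ x) ⊛ ((𝟙 ⊖ x) ⊛ h)) n ≡
          (h n ℤ.- (x ⊛ h) n) ℤ.- ((x ⊛ h) n ℤ.- (x ⊛ (x ⊛ h)) n)
[𝟙⊖x]²⊛ x h n = trans ([𝟙⊖x]⊛ x ((𝟙 ⊖ x) ⊛ h) n) (cong₂ ℤ._-_ ([𝟙⊖x]⊛ x h n)
  (trans (⊛-congˡ x ([𝟙⊖x]⊛ x h) n) (⊛-distribˡ-⊖ x h (x ⊛ h) n)))

-- Modulo `p`, only exponents congruent to `r` occur in `f`. The disjunction lets closure properties
-- be proved by case analysis, and an integer `r` keeps the subtraction untruncated.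
record Supported (p r : ℤ) (f : Series) : Set where
  field at : ∀ n → p ∣ f n ⊎ p ∣ + n ℤ.- r

open Supported

supported-resp-≗ : f ≗ g → Supported p r f → Supported p r g
supported-resp-≗ {p = p} f≗g F .at n = map₁ (subst (p ∣_) (f≗g n)) (F .at n)

supported-resp-≡mod : p ∣ r ℤ.- s → Supported p r f → Supported p s f
supported-resp-≡mod {p} {r} {s} p∣r-s F .at n =
  map₂ (λ p∣n-r → subst (p ∣_) (ring (+ n) r s) (∣m∣n⇒∣m+n p∣n-r p∣r-s)) (F .at n)
  where
  ring : ∀ a b c → (a ℤ.- b) ℤ.+ (b ℤ.- c) ≡ a ℤ.- c
  ring = solve-∀

supported-⊖ : Supported p r f → Supported p r g → Supported p r (f ⊖ g)
supported-⊖ F G .at n with F .at n | G .at n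
... | inj₂ n≡r  | _         = inj₂ n≡r
... | inj₁ _    | inj₂ n≡r  = inj₂ n≡r
... | inj₁ p∣fn | inj₁ p∣gn = inj₁ (∣m∣n⇒∣m-n p∣fn p∣gn)

supported-q^ : ∀ m → Supported p (+ m) (q^ m)
supported-q^ {p} m .at n with n ℕ.≟ m
... | yes refl = inj₂ (subst (p ∣_) (sym (ℤ.+-inverseʳ (+ n))) (divides 0ℤ refl))
... | no  n≢m  = inj₁ (divides 0ℤ
  (cong (if_then 1ℤ else 0ℤ) (dec-false (n ℕ.≟ m) n≢m)))

-- `Q` is the same for all terms, so one term that yields it settles the whole sum.
∣-sum-⊎ : ∀ {n} {Q : Set} (t : Fin n → ℤ) → (∀ i → p ∣ t i ⊎ Q) → p ∣ sum t ⊎ Q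
∣-sum-⊎ {n = zero}  t p∣t = inj₁ (divides 0ℤ refl)
∣-sum-⊎ {n = suc n} t p∣t
  with p∣t Fin.zero | ∣-sum-⊎ (λ i → t (Fin.suc i)) (λ i → p∣t (Fin.suc i))
... | inj₂ q    | _         = inj₂ q
... | inj₁ _    | inj₂ q    = inj₂ q
... | inj₁ p∣t₀ | inj₁ p∣ts = inj₁ (∣m∣n⇒∣m+n p∣t₀ p∣ts)

-- Exponents add under multiplication, hence so do their residues.
supported-⊛ : Supported p r f → Supported p s g → Supported p (r ℤ.+ s) (f ⊛ g)
supported-⊛ {p} {r} {f} {s} {g} F G .at n =
  ∣-sum-⊎ {n = suc n} (λ i → f (toℕ i) ℤ.* g (n ∸ toℕ i)) term
  where
  ring : ∀ a b c d → (a ℤ.- c) ℤ.+ (b ℤ.- d) ≡ (a ℤ.+ b) ℤ.- (c ℤ.+ d)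
  ring = solve-∀

  term : (i : Fin (suc n)) →
         p ∣ f (toℕ i) ℤ.* g (n ∸ toℕ i) ⊎ p ∣ + n ℤ.- (r ℤ.+ s)
  term i with F .at (toℕ i) | G .at (n ∸ toℕ i)
  ... | inj₁ p∣f | _        = inj₁ (∣m⇒∣m*n _ p∣f)
  ... | inj₂ _   | inj₁ p∣g = inj₁ (∣n⇒∣m*n (f (toℕ i)) p∣g)
  -- Since `i` is at most `n`, the truncated difference is exact and the two exponents add up to
  -- `n`.
  ... | inj₂ i≡r | inj₂ j≡s = inj₂ (subst (p ∣_)
    (trans (ring (+ toℕ i) (+ (n ∸ toℕ i)) r s)
      (cong (λ k → + k ℤ.- (r ℤ.+ s)) (ℕ.m+[n∸m]≡n (toℕ≤pred[n] i))))
    (∣m∣n⇒∣m+n i≡r j≡s))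

supported-∏≤ : ∀ (F : ℕ → Series) → (∀ m → Supported p 0ℤ (F m)) →
               ∀ N → Supported p 0ℤ (∏≤ N F)
supported-∏≤ F S zero    = supported-q^ 0
supported-∏≤ F S (suc N) = supported-⊛ (supported-∏≤ F S N) (S (suc N))

supported-∏∞ : ∀ (F : ℕ → Series) → (∀ m → Supported p 0ℤ (F m)) →
               Supported p 0ℤ (∏∞ F)
supported-∏∞ F S .at n = supported-∏≤ F S n .at n

-- With x = q^m, (1 - x)^2 = 1 - 2(x - x^2) - x^2. The middle term vanishes modulo 2, and x^2 shifts
-- exponents by 2m. Writing the last term with a minus sign leaves only differences, as
-- `supported-⊖` requires.
frobenius₂ : ∀ m → Supported (+ 2) 0ℤ h →
             Supported (+ 2) 0ℤ ((𝟙 ⊖ q^ m) ⊛ ((𝟙 ⊖ q^ m) ⊛ h))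
frobenius₂ {h} m H = supported-resp-≗ (λ n → sym (expand n))
  (supported-⊖ (supported-⊖ H multiple) x²h)
  where
  x = q^ m

  multiple : Supported (+ 2) 0ℤ λ n → + 2 ℤ.* ((x ⊛ h) n ℤ.- (x ⊛ (x ⊛ h)) n)
  multiple .at n = inj₁ (∣m⇒∣m*n _ ∣-refl)

  x²h : Supported (+ 2) 0ℤ (x ⊛ (x ⊛ h))
  x²h = supported-resp-≡mod (divides (+ m) (2m (+ m)))
    (supported-⊛ (supported-q^ m) (supported-⊛ (supported-q^ m) H))
    where
    2m : ∀ a → (a ℤ.+ (a ℤ.+ 0ℤ)) ℤ.- 0ℤ ≡ a ℤ.* + 2
    2m = solve-∀

  expand : ∀ n → ((𝟙 ⊖ x) ⊛ ((𝟙 ⊖ x) ⊛ h)) n ≡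
           (h n ℤ.- + 2 ℤ.* ((x ⊛ h) n ℤ.- (x ⊛ (x ⊛ h)) n)) ℤ.- (x ⊛ (x ⊛ h)) n
  expand n = trans ([𝟙⊖x]²⊛ x h n) (ring (h n) _ _)
    where
    ring : ∀ a b c → (a ℤ.- b) ℤ.- (b ℤ.- c) ≡ (a ℤ.- + 2 ℤ.* (b ℤ.- c)) ℤ.- c
    ring = solve-∀

-- Likewise (1 - x)^3 = 1 - 3(x - x^2) - x^3, where x^3 shifts exponents by 3m.
frobenius₃ : ∀ m → Supported (+ 3) 0ℤ h →
             Supported (+ 3) 0ℤ ((𝟙 ⊖ q^ m) ⊛ ((𝟙 ⊖ q^ m) ⊛ ((𝟙 ⊖ q^ m) ⊛ h)))
frobenius₃ {h} m H = supported-resp-≗ (λ n → sym (expand n))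
  (supported-⊖ (supported-⊖ H multiple) x³h)
  where
  x = q^ m

  multiple : Supported (+ 3) 0ℤ λ n → + 3 ℤ.* ((x ⊛ h) n ℤ.- (x ⊛ (x ⊛ h)) n)
  multiple .at n = inj₁ (∣m⇒∣m*n _ ∣-refl)

  x³h : Supported (+ 3) 0ℤ (x ⊛ (x ⊛ (x ⊛ h)))
  x³h = supported-resp-≡mod (divides (+ m) (3m (+ m)))
    (supported-⊛ (supported-q^ m)
      (supported-⊛ (supported-q^ m) (supported-⊛ (supported-q^ m) H)))
    where
    3m : ∀ a → (a ℤ.+ (a ℤ.+ (a ℤ.+ 0ℤ))) ℤ.- 0ℤ ≡ a ℤ.* + 3
    3m = solve-∀

  expand : ∀ n → ((𝟙 ⊖ x) ⊛ ((𝟙 ⊖ x) ⊛ ((𝟙 ⊖ x) ⊛ h))) n ≡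
           (h n ℤ.- + 3 ℤ.* ((x ⊛ h) n ℤ.- (x ⊛ (x ⊛ h)) n)) ℤ.-
           (x ⊛ (x ⊛ (x ⊛ h))) n
  -- The outer two factors are expanded first, around the innermost product; `xd` and `xxd` then
  -- expand what remains.
  expand n = trans ([𝟙⊖x]²⊛ x ((𝟙 ⊖ x) ⊛ h) n) (trans
    (cong₂ ℤ._-_ (cong₂ ℤ._-_ ([𝟙⊖x]⊛ x h n) (xd n)) (cong₂ ℤ._-_ (xd n) xxd))
    (ring (h n) _ _ _))
    where
    xd : x ⊛ ((𝟙 ⊖ x) ⊛ h) ≗ (x ⊛ h) ⊖ (x ⊛ (x ⊛ h))
    xd k = trans (⊛-congˡ x ([𝟙⊖x]⊛ x h) k) (⊛-distribˡ-⊖ x h (x ⊛ h) k)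

    xxd : (x ⊛ (x ⊛ ((𝟙 ⊖ x) ⊛ h))) n ≡ (x ⊛ (x ⊛ h)) n ℤ.- (x ⊛ (x ⊛ (x ⊛ h))) n
    xxd = trans (⊛-congˡ x xd n) (⊛-distribˡ-⊖ x (x ⊛ h) (x ⊛ (x ⊛ h)) n)

    ring : ∀ a b c d →
      ((a ℤ.- b) ℤ.- (b ℤ.- c)) ℤ.- ((b ℤ.- c) ℤ.- (c ℤ.- d)) ≡
      (a ℤ.- + 3 ℤ.* (b ℤ.- c)) ℤ.- d
    ring = solve-∀

-- With the exponent written `k * 2`, a successor step unfolds definitionally to exactly two more
-- factors.
supported₂-^ : ∀ m k → Supported (+ 2) 0ℤ ((𝟙 ⊖ q^ m) ⊛^ (k * 2))
supported₂-^ m zero    = supported-q^ 0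
supported₂-^ m (suc k) = frobenius₂ m (supported₂-^ m k)

supported₃-^ : ∀ m k → Supported (+ 3) 0ℤ ((𝟙 ⊖ q^ m) ⊛^ (k * 3))
supported₃-^ m zero    = supported-q^ 0
supported₃-^ m (suc k) = frobenius₃ m (supported₃-^ m k)

-- The leading factor q moves the residue from 0 to 1.
supported-Δ : (∀ m → Supported p 0ℤ (factor m)) → Supported p 1ℤ Δ
supported-Δ S =
  supported-⊛ (supported-q^ 1) (supported-∏∞ factor S)

supported⇒≡0 : ∀ p n → Supported (+ p) r f → ¬ (+ p ∣ + n ℤ.- r) → f n ≡ 0ℤ mod p
-- `∣⇒∣ᵤ` passes from signed divisibility to the unsigned one behind `_≡_mod_`.
supported⇒≡0 {f = f} p n F n≢r = ∣⇒∣ᵤ (subst (+ p ∣_) (sym (ℤ.+-identityʳ (f n)))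
  ([ (λ p∣fn → p∣fn) , (λ n≡r → contradiction n≡r n≢r) ]′ (F .at n)))

m∤mn-k : ∀ m n k → ¬ (+ m ∣ k) → ¬ (+ m ∣ + (m * n) ℤ.- k)
m∤mn-k m n k m∤k m∣mn-k = m∤k (subst (+ m ∣_) (ring (+ (m * n)) k)
  (∣m∣n⇒∣m-n (divides (+ n) (trans (cong +_ (ℕ.*-comm m n)) (ℤ.pos-* n m))) m∣mn-k))
  where
  ring : ∀ a b → a ℤ.- (a ℤ.- b) ≡ b
  ring = solve-∀

corollary2p5 : (n : ℕ) → 1 ≤ n →
    (τ (2 * n) ≡ 0ℤ mod 2) × (τ (3 * n ∸ 1) ≡ 0ℤ mod 3) × (τ (3 * n) ≡ 0ℤ mod 3)
corollary2p5 n@(suc k) _ =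
    supported⇒≡0 2 (2 * n) Δ₂ (m∤mn-k 2 n 1ℤ (from-no (+ 2 ∣? 1ℤ)))
  -- The distance to residue 1 is (3n - 1) - 1 = 3n - 2, hence the constant 2. As `n` is a
  -- successor, `∸ 1` is a true predecessor and adding 1 back computes to `3 * n`.
  , supported⇒≡0 3 (3 * n ∸ 1) Δ₃ (λ 3∣ → m∤mn-k 3 n (+ 2) (from-no (+ 3 ∣? + 2))
      (subst (+ 3 ∣_) (ring (+ (3 * n ∸ 1))) 3∣))
  , supported⇒≡0 3 (3 * n) Δ₃ (m∤mn-k 3 n 1ℤ (from-no (+ 3 ∣? 1ℤ)))
  where
  -- The exponent 24 of each factor is `12 * 2` here and `8 * 3` in `Δ₃`.
  Δ₂ : Supported (+ 2) 1ℤ Δ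
  Δ₂ = supported-Δ λ m → supported₂-^ m 12

  Δ₃ : Supported (+ 3) 1ℤ Δ
  Δ₃ = supported-Δ λ m → supported₃-^ m 8

  ring : ∀ a → a ℤ.- 1ℤ ≡ (1ℤ ℤ.+ a) ℤ.- + 2
  ring = solve-∀
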